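{- Let $\kappa$ be an infinite cardinal with $\kappa^{<\kappa}=\kappa$, and let $\varphi$ be a weakly $\kappa$-scattered linear order type of size at most $\kappa$. Then there is a weakly $\kappa$-scattered linear order type $\tau$ of size at most $\kappa$ such that, for all $n<\omega$, $\tau\longrightarrow(\varphi,n)^2$.
   Context: A linear order $P$ (and its order type) is $\kappa$-saturated if $P\neq\emptyset$ and, for all $A,B\subseteq P$ (one or both possibly empty) with $|A|,|B|<\kappa$ and $A<_P B$ (i.e. $a<_P b$ for all $a\in A$, $b\in B$), there is $c\in P$ with $A<_P c<_P B$. For infinite regular $\kappa$, a linear order (type) is weakly $\kappa$-scattered if it has no $\kappa$-saturated suborder. The size of an order type is the cardinality of any order of that type. For linear order types $\tau,\varphi$ and $n<\omega$, $\tau\longrightarrow(\varphi,n)^2$ means: whenever $P$ is a linear order of type $\tau$ and $f:[P]^2\to\{0,1\}$ (where $[P]^2$ is the set of two-element subsets of $P$), either there is a suborder $Q\subseteq P$ of type $\varphi$ with $f$ constantly $0$ on $[Q]^2$, or there is $Q\subseteq P$ with $n$ elements with $f$ constantly $1$ on $[Q]^2$. -}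

module Defs where

open import Level using (0ℓ)
open import Data.Nat.Base using (ℕ)
open import Data.Fin.Base using (Fin; zero; suc)
open import Data.Product.Base using (∃; _×_; _,_; proj₁; proj₂)
open import Data.Sum.Base using (_⊎_)
open import Data.Refinement.Base using (Refinement-syntax; _,_; value)
open import Function.Bundles using (_↣_; _⤖_)
open import Relation.Binary.Core using (Rel)
open import Relation.Binary.Definitions using (Trichotomous; tri<; tri≈; tri>)
open import Relation.Binary.Structures using (IsStrictTotalOrder)
open import Relation.Binary.Morphism.Structures using (IsOrderIsomorphism)
open import Relation.Binary.PropositionalEquality
  using (_≡_; refl; cong; isEquivalence; resp₂)
open import Relation.Nullary.Negation.Core using (¬_)
open import Relation.Unary using (Pred)

-- A cardinal is represented by any type of that cardinality; every notion
-- below depends on the type only up to bijection.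

infix 4 _≼_ _≺_

_≼_ _≺_ : Set → Set → Set
A ≼ B = A ↣ B
A ≺ B = (A ≼ B) × ¬ (B ≼ A)

Infinite : Set → Set
Infinite K = ¬ (∃ λ n → K ⤖ Fin n)

-- M has cardinality κ^{<κ} = sup { κ^λ ∣ λ < κ }, where κ = |K|.  The
-- function type L → K represents κ^λ, for λ = |L|, in the presence of
-- function extensionality.
IsWeakPower : (K M : Set) → Set₁
IsWeakPower K M = (∀ L → L ≺ K → (L → K) ≼ M)
                × (∀ N → (∀ L → L ≺ K → (L → K) ≼ N) → M ≼ N)

record LinearOrder : Set₁ where
  infix 4 _<_
  field
    Carrier            : Set
    _<_                : Rel Carrier 0ℓ
    isStrictTotalOrder : IsStrictTotalOrder _≡_ _<_
  open IsStrictTotalOrder isStrictTotalOrder public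

open LinearOrder using (Carrier)

-- An order type is represented by any order of that type.
infix 4 _≅_

_≅_ : LinearOrder → LinearOrder → Set
P ≅ Q = ∃ (IsOrderIsomorphism _≡_ _≡_ (LinearOrder._<_ P) (LinearOrder._<_ Q))

-- Membership proofs are irrelevant in ⟪ S ⟫, so that its elements are those
-- of S, without multiplicity.
⟪_⟫ : {A : Set} → Pred A 0ℓ → Set
⟪_⟫ {A} S = [ x ∈ A ∣ S x ]

Suborder : (P : LinearOrder) → Pred (Carrier P) 0ℓ → LinearOrder
Suborder P S = record
  { Carrier            = ⟪ S ⟫
  ; _<_                = _<ₛ_
  ; isStrictTotalOrder = record
    { isStrictPartialOrder = record
      { isEquivalence = isEquivalence
      ; irrefl        = λ { refl → irrefl refl }
      ; trans         = trans
      ; <-resp-≈      = resp₂ _<ₛ_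
      }
    ; compare = cmp
    }
  }
  where
  open LinearOrder P hiding (Carrier; isEquivalence)

  _<ₛ_ : Rel ⟪ S ⟫ 0ℓ
  x <ₛ y = value x < value y

  cmp : Trichotomous _≡_ _<ₛ_
  cmp (x , p) (y , q) with compare x y
  ... | tri< x<y x≢y y≮x  = tri< x<y (λ e → x≢y (cong value e)) y≮x
  ... | tri≈ x≮y refl y≮x = tri≈ x≮y refl y≮x
  ... | tri> x≮y x≢y y<x  = tri> x≮y (λ e → x≢y (cong value e)) y<x

Saturated : Set → LinearOrder → Set₁
Saturated K P =
  Carrier P ×
  (∀ (A B : Pred (Carrier P) 0ℓ) → ⟪ A ⟫ ≺ K → ⟪ B ⟫ ≺ K →
   (∀ a b → A a → B b → a < b) →
   ∃ λ c → (∀ a → A a → a < c) × (∀ b → B b → c < b))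
  where open LinearOrder P using (_<_)

WeaklyScattered : Set → LinearOrder → Set₁
WeaklyScattered K P = ¬ (∃ λ (S : Pred (Carrier P) 0ℓ) → Saturated K (Suborder P S))

-- In a linear order, a two-element subset is the same as an increasing pair.
[_]² : LinearOrder → Set
[ P ]² = [ p ∈ Carrier P × Carrier P ∣ proj₁ p < proj₂ p ]
  where open LinearOrder P using (_<_)

-- f is constantly i on [Q]².
ConstantOn : (P : LinearOrder) → ([ P ]² → Fin 2) → Fin 2 → Pred (Carrier P) 0ℓ → Set
ConstantOn P f i Q =
  ∀ (p : [ P ]²) → Q (proj₁ (value p)) → Q (proj₂ (value p)) → f p ≡ i

infix 4 _⟶⟨_,_⟩²

_⟶⟨_,_⟩² : LinearOrder → LinearOrder → ℕ → Set₁
τ ⟶⟨ φ , n ⟩² =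
  ∀ (P : LinearOrder) → P ≅ τ → (f : [ P ]² → Fin 2) →
    (∃ λ (Q : Pred (Carrier P) 0ℓ) → Suborder P Q ≅ φ × ConstantOn P f zero Q)
  ⊎ (∃ λ (Q : Pred (Carrier P) 0ℓ) → ⟪ Q ⟫ ⤖ Fin n × ConstantOn P f (suc zero) Q)

{-# OPTIONS --safe #-}
-- Call τ a bound for n if τ ⟶ (φ, n)².  If τ is a bound for n, then a bound for
-- n + 1 is obtained as follows: well-order φ with all initial segments of size
-- < κ, and let τ′ be the lexicographic sum, over p ∈ φ, of the lexicographic
-- powers τ^{q ∣ q ⊏ p}, of size κ^{<κ} = κ.  Given a graph on τ′ in which some
-- neighbourhood contains a copy of τ, the bound for n applies there.  Otherwise
-- choose x_p in the p-th summand by recursion along ⊏, avoiding the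
-- neighbourhood N(x_q) of each q ⊏ p by a suitable choice of the q-th
-- coordinate: if no value r of that coordinate did, then a choice of
-- y_r ∈ N(x_q) for each r would be a copy of τ.  So {x_p} is an independent copy
-- of φ.  The sum of bounds for all n is as wanted.
module Submission where

open import Defs
open import Axiom.ExcludedMiddle using (ExcludedMiddle)
open import Axiom.Extensionality.Propositional using (Extensionality)
open import Data.Bool.Base using (Bool; true)
open import Data.Bool.Properties using (⇔→≡)
open import Data.Empty using (⊥; ⊥-elim)
open import Data.Fin.Base using (Fin; zero; suc; toℕ; fromℕ<)
open import Data.Fin.Properties using (toℕ-injective; toℕ<n; toℕ-fromℕ<; injective⇒≤)
open import Data.Irrelevant using ([_])
open import Data.Maybe.Base using (Maybe; just; nothing)
open import Data.Maybe.Properties using (just-injective)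
open import Data.Nat.Base using (ℕ; zero; suc)
import Data.Nat.Base as ℕ
import Data.Nat.Induction as ℕ
import Data.Nat.Properties as ℕ
open import Data.Product.Base using (Σ; ∃; _×_; _,_; proj₁; proj₂; swap)
open import Data.Refinement.Base using (_,_; value)
open import Data.Sum.Base using (_⊎_; inj₁; inj₂; [_,_]′; fromInj₁)
open import Data.Unit.Base using (⊤; tt)
open import Function.Base using (_∘_; const; case_of_)
open import Function.Bundles using (_⤖_; mk↣; mk⤖; mk⇔; Injection)
open import Function.Properties.Bijection using (sym-≡)
open import Function.Properties.Injection using (↣-trans)
open import Induction.WellFounded using (WellFounded; Acc; acc; module All; module FixPoint)
open import Level using (0ℓ)
open import Relation.Binary.Core using (Rel)
open import Relation.Binary.Definitions
  using (Symmetric; Transitive; Tri; tri<; tri≈; tri>)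
import Relation.Binary.Construct.On as On
open import Relation.Binary.Morphism.Structures using (IsOrderIsomorphism)
open import Relation.Binary.PropositionalEquality
  using (_≡_; _≢_; refl; sym; trans; cong; cong₂; cong-app; subst; subst₂; isEquivalence; resp₂)
open import Relation.Nullary using (¬_; Dec; yes; no; does; contradiction; recompute)
open import Relation.Nullary.Decidable using (decidable-stable; dec-true)
open import Relation.Unary using (Pred)

open LinearOrder using (Carrier)
open Injection using (to; injective)

-- Linear orders, embeddings and comparison of sizes.

infix 4 _[_<_]

_[_<_] : (P : LinearOrder) → Rel (Carrier P) 0ℓ
_[_<_] = LinearOrder._<_

linear : (A : Set) (_<_ : Rel A 0ℓ) → (∀ {x} → ¬ x < x) → Transitive _<_ →
         (∀ x y → x < y ⊎ x ≡ y ⊎ y < x) → LinearOrder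
linear A _<_ irrefl transitive total = record
  { Carrier            = A
  ; _<_                = _<_
  ; isStrictTotalOrder = record
    { isStrictPartialOrder = record
      { isEquivalence = isEquivalence
      ; irrefl        = λ { refl → irrefl }
      ; trans         = transitive
      ; <-resp-≈      = resp₂ _<_
      }
    ; compare = compare
    }
  }
  where
  compare : ∀ x y → Tri (x < y) (x ≡ y) (y < x)
  compare x y with total x y
  ... | inj₁ x<y         = tri< x<y (λ { refl → irrefl x<y }) (irrefl ∘ transitive x<y)
  ... | inj₂ (inj₁ refl) = tri≈ irrefl refl irrefl
  ... | inj₂ (inj₂ y<x)  = tri> (irrefl ∘ transitive y<x) (λ { refl → irrefl y<x }) y<x

infix 4 _↪_

_↪_ : LinearOrder → LinearOrder → Set
P ↪ Q = Σ (Carrier P → Carrier Q) λ m → ∀ {x y} → P [ x < y ] → Q [ m x < m y ]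

↪-trans : ∀ {P Q R} → P ↪ Q → Q ↪ R → P ↪ R
↪-trans (m , m-mono) (n , n-mono) = n ∘ m , n-mono ∘ m-mono

↪-reflects-< : ∀ {P Q} (m : P ↪ Q) {x y} → Q [ proj₁ m x < proj₁ m y ] → P [ x < y ]
↪-reflects-< {P} {Q} (m , mono) {x} {y} mx<my with LinearOrder.compare P x y
... | tri< x<y _ _  = x<y
... | tri≈ _ refl _ = ⊥-elim (LinearOrder.irrefl Q refl mx<my)
... | tri> _ _ y<x  = ⊥-elim (LinearOrder.asym Q mx<my (mono y<x))

↪-injective : ∀ {P Q} (m : P ↪ Q) {x y} → proj₁ m x ≡ proj₁ m y → x ≡ y
↪-injective {P} {Q} (m , mono) {x} {y} mx≡my with LinearOrder.compare P x y
... | tri< x<y _ _ = ⊥-elim (LinearOrder.irrefl Q mx≡my (mono x<y))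
... | tri≈ _ x≡y _ = x≡y
... | tri> _ _ y<x = ⊥-elim (LinearOrder.irrefl Q (sym mx≡my) (mono y<x))

value-injection : {A : Set} (S : Pred A 0ℓ) → ⟪ S ⟫ ≼ A
value-injection S = mk↣ {to = value} λ { {_ , _} {_ , _} refl → refl }

≼-≺-trans : ∀ {A B C} → A ≼ B → B ≺ C → A ≺ C
≼-≺-trans A≼B (B≼C , C⋠B) = ↣-trans A≼B B≼C , λ C≼A → C⋠B (↣-trans C≼A A≼B)

Σ-≼ : {A A′ B′ : Set} {B : A → Set} → A ≼ A′ → (∀ x → B x ≼ B′) → Σ A B ≼ (A′ × B′)
Σ-≼ {B = B} i j = mk↣ {to = λ (x , y) → to i x , to (j x) y}
  λ e → inj (injective i (cong proj₁ e)) (cong proj₂ e)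
  where
  inj : ∀ {x x′} {y : B x} {y′ : B x′} → x ≡ x′ → to (j x) y ≡ to (j x′) y′ → (x , y) ≡ (x′ , y′)
  inj refl e = cong (_ ,_) (injective (j _) e)

-- Well-orderings.

record WellOrdering (A : Set) : Set₁ where
  infix 4 _⊏_
  field
    _⊏_         : Rel A 0ℓ
    irrefl      : ∀ {x} → ¬ x ⊏ x
    transitive  : Transitive _⊏_
    total       : ∀ x y → x ⊏ y ⊎ x ≡ y ⊎ y ⊏ x
    wellFounded : WellFounded _⊏_

  Segment : A → Set
  Segment x = ⟪ _⊏ x ⟫

pullback : {A B : Set} → A ≼ B → WellOrdering B → WellOrdering A
pullback i W = record
  { _⊏_         = λ x y → to i x ⊏ to i y
  ; irrefl      = irrefl
  ; transitive  = transitive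
  ; total       = λ x y → case total (to i x) (to i y) of λ where
      (inj₁ lt)        → inj₁ lt
      (inj₂ (inj₁ eq)) → inj₂ (inj₁ (injective i eq))
      (inj₂ (inj₂ gt)) → inj₂ (inj₂ gt)
  ; wellFounded = On.wellFounded (to i) wellFounded
  }
  where open WellOrdering W

-- Lexicographic sums and the arrow relation.

ℕ-order : LinearOrder
ℕ-order = record { isStrictTotalOrder = ℕ.<-isStrictTotalOrder }

module _ (P : LinearOrder) (Q : Carrier P → LinearOrder) where

  data _<Σ_ : Rel (Σ (Carrier P) (Carrier ∘ Q)) 0ℓ where
    fst< : ∀ {p p′ x y} → P [ p < p′ ] → (p , x) <Σ (p′ , y)
    snd< : ∀ {p x y} → Q p [ x < y ] → (p , x) <Σ (p , y)

  LexSum : LinearOrder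
  LexSum = linear _ _<Σ_ irrefl transitive total
    where
    irrefl : ∀ {x} → ¬ x <Σ x
    irrefl (fst< lt)     = LinearOrder.irrefl P refl lt
    irrefl (snd< {p} lt) = LinearOrder.irrefl (Q p) refl lt

    transitive : Transitive _<Σ_
    transitive (fst< lt)     (fst< lt′) = fst< (LinearOrder.trans P lt lt′)
    transitive (fst< lt)     (snd< lt′) = fst< lt
    transitive (snd< lt)     (fst< lt′) = fst< lt′
    transitive (snd< {p} lt) (snd< lt′) = snd< (LinearOrder.trans (Q p) lt lt′)

    total : ∀ x y → x <Σ y ⊎ x ≡ y ⊎ y <Σ x
    total (p , x) (q , y) with LinearOrder.compare P p q
    ... | tri< lt _ _   = inj₁ (fst< lt)
    ... | tri> _ _ gt   = inj₂ (inj₂ (fst< gt))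
    ... | tri≈ _ refl _ with LinearOrder.compare (Q p) x y
    ...   | tri< lt _ _   = inj₁ (snd< lt)
    ...   | tri≈ _ refl _ = inj₂ (inj₁ refl)
    ...   | tri> _ _ gt   = inj₂ (inj₂ (snd< gt))

  summand : ∀ p → Q p ↪ LexSum
  summand p = (p ,_) , snd<

-- σ ⟶ (φ, n)², with the colouring given by the graph of the pairs of colour 1.
Arrow : (σ φ : LinearOrder) → ℕ → Set₁
Arrow σ φ n = (R : Rel (Carrier σ) 0ℓ) → Symmetric R → (∀ {x} → ¬ R x x) →
    (Σ (φ ↪ σ) λ h → ∀ p q → ¬ R (proj₁ h p) (proj₁ h q))
  ⊎ (Σ (Fin n → Carrier σ) λ g → ∀ {i j} → i ≢ j → R (g i) (g j))

Arrow-↪ : ∀ {σ τ φ n} → σ ↪ τ → Arrow σ φ n → Arrow τ φ n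
Arrow-↪ {σ} {τ} {φ} e a R R-sym R-irr with a (λ x y → R (proj₁ e x) (proj₁ e y)) R-sym R-irr
... | inj₁ (h , ind) = inj₁ (↪-trans {φ} {σ} {τ} h e , ind)
... | inj₂ (g , clq) = inj₂ (proj₁ e ∘ g , clq)

-- Saturation and scatteredness in terms of families and embeddings.

record Sat (K : Set) (X : LinearOrder) : Set₁ where
  field
    point : Carrier X
    fill  : ∀ {I J} → I ≺ K → J ≺ K → (a : I → Carrier X) (b : J → Carrier X) →
            (∀ i j → X [ a i < b j ]) →
            ∃ λ c → (∀ i → X [ a i < c ]) × (∀ j → X [ c < b j ])

-- A form of `WeaklyScattered` that is easier to transport: suborders become embeddings of arbitrary
-- orders, and the subsets in the definition of saturation become indexed families, which can be
-- composed with a map.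
Scattered : Set → LinearOrder → Set₁
Scattered K P = ∀ X → Sat K X → ¬ (X ↪ P)

-- Well-founded trees in the role of ordinals: `sup I f` is the least stage after all the `f i`.
-- They index the transfinite construction in Zermelo's theorem.
data Tower : Set₁ where
  sup : (I : Set) → (I → Tower) → Tower

-- Minimal elements and recursive choice.

module Classical (em : ∀ {ℓ} → ExcludedMiddle ℓ) (ext : ∀ {a b} → Extensionality a b) where

  dne : ∀ {ℓ} {P : Set ℓ} → ¬ ¬ P → P
  dne = decidable-stable em

  minimal : ∀ {A : Set} {_<_ : Rel A 0ℓ} → WellFounded _<_ → ∀ {ℓ} {P : Pred A ℓ} → ∃ P →
            ∃ λ x → P x × (∀ y → y < x → ¬ P y)
  minimal {_<_ = _<_} wf {P = P} (x , Px) = go x (wf x) Px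
    where
    go : ∀ x → Acc _<_ x → P x → ∃ λ x → P x × (∀ y → y < x → ¬ P y)
    go x (acc rs) Px with em {P = ∃ λ y → y < x × P y}
    ... | yes (y , y<x , Py) = go y (rs y<x) Py
    ... | no ¬smaller        = x , Px , λ y y<x Py → ¬smaller (y , y<x , Py)

  module _ {A : Set} {_<_ : Rel A 0ℓ} (wf : WellFounded _<_) {V : A → Set} (default : ∀ x → V x)
           (Good : ∀ x → (∀ y → y < x → V y) → V x → Set) where

    opaque
      -- At each `x`, `pick` takes a good value if there is one and the default otherwise. Since
      -- `Good x` looks only at values below `x`, `step` can be stated for total `f`; well-founded
      -- induction then shows that the default is never taken.
      dependentChoice : (∀ x (f : ∀ y → V y) → (∀ y → y < x → Good y (λ z _ → f z) (f y)) →
                          ∃ (Good x (λ y _ → f y))) →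
                        Σ (∀ x → V x) λ f → ∀ x → Good x (λ y _ → f y) (f x)
      dependentChoice step = f , All.wfRec wf 0ℓ _ (λ x good → good-f x (λ y y<x → good y<x))
        where
        pick : ∀ x → (∀ y → y < x → V y) → V x
        pick x g with em {P = ∃ (Good x g)}
        ... | yes (v , _) = v
        ... | no  _       = default x

        pick-good : ∀ x g → ∃ (Good x g) → Good x g (pick x g)
        pick-good x g ex with em {P = ∃ (Good x g)}
        ... | yes (_ , good) = good
        ... | no ¬ex         = contradiction ex ¬ex

        rec : ∀ x → (∀ {y} → y < x → V y) → V x
        rec x g = pick x (λ y → g {y})

        f : ∀ x → V x
        f = All.wfRec wf 0ℓ V rec

        f-unfold : ∀ x → f x ≡ pick x (λ y _ → f y)
        f-unfold x = FixPoint.unfold-wfRec wf V rec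
          (λ x eq → cong (pick x) (ext λ y → ext λ y<x → eq y<x)) {x}

        good-f : ∀ x → (∀ y → y < x → Good y (λ z _ → f z) (f y)) → Good x (λ y _ → f y) (f x)
        good-f x good = subst (Good x _) (sym (f-unfold x)) (pick-good x _ (step x f good))

  -- Zermelo's theorem: starting from ∅, adjoin fresh elements until none is left.
  module Zermelo (A : Set) where

    infix 4 _∈_ _∈⁺_ _⊆_ _⁺⊆_

    -- Subsets are Boolean-valued so that mutual inclusion gives equality by extensionality; stages
    -- with the same elements then have the same fresh element.
    _∈_ : A → (A → Bool) → Set
    x ∈ B = B x ≡ true

    fresh : (A → Bool) → Maybe A
    fresh B with em {P = ∃ λ x → ¬ x ∈ B}
    ... | yes (x , _) = just x
    ... | no _        = nothing

    fresh-∉ : ∀ B {x} → fresh B ≡ just x → ¬ x ∈ B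
    fresh-∉ B e with em {P = ∃ λ x → ¬ x ∈ B}
    fresh-∉ B refl | yes (_ , x∉B) = x∉B
    fresh-∉ B ()   | no _

    fresh-exists : ∀ B {x} → ¬ x ∈ B → ∃ λ y → fresh B ≡ just y
    fresh-exists B x∉B with em {P = ∃ λ x → ¬ x ∈ B}
    ... | yes (y , _) = y , refl
    ... | no full     = contradiction (_ , x∉B) full

    _∈⁺_ : A → (A → Bool) → Set
    x ∈⁺ B = x ∈ B ⊎ fresh B ≡ just x

    _⊆_ _⁺⊆_ : Rel (A → Bool) 0ℓ
    B ⊆  C = ∀ {x} → x ∈ B → x ∈ C
    B ⁺⊆ C = ∀ {x} → x ∈⁺ B → x ∈ C

    ⊆-antisym : ∀ {B C} → B ⊆ C → C ⊆ B → B ≡ C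
    ⊆-antisym B⊆C C⊆B = ext λ x → ⇔→≡ (mk⇔ B⊆C C⊆B)

    ⟦_⟧ : Tower → A → Bool
    ⟦ sup I f ⟧ x = does (em {P = ∃ λ i → x ∈⁺ ⟦ f i ⟧})

    ∈-sup⁺ : ∀ {I} (f : I → Tower) i → ⟦ f i ⟧ ⁺⊆ ⟦ sup I f ⟧
    ∈-sup⁺ f i x∈⁺ = dec-true em (i , x∈⁺)

    ∈-sup⁻ : ∀ {I} (f : I → Tower) {x} → x ∈ ⟦ sup I f ⟧ → ∃ λ i → x ∈⁺ ⟦ f i ⟧
    ∈-sup⁻ f {x} e with em {P = ∃ λ i → x ∈⁺ ⟦ f i ⟧}
    ... | yes p = p
    ∈-sup⁻ f () | no _

    Comparable : Tower → Tower → Set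
    Comparable s t = (⟦ s ⟧ ⊆ ⟦ t ⟧ ⊎ ⟦ t ⟧ ⁺⊆ ⟦ s ⟧) × (⟦ t ⟧ ⊆ ⟦ s ⟧ ⊎ ⟦ s ⟧ ⁺⊆ ⟦ t ⟧)

    -- If each `f i` stays inside `t` even after its fresh element is adjoined, then so does the
    -- supremum. Otherwise take an exception `i`: comparability leaves only that `f i` includes `t`
    -- with its fresh element, or that `f i` and `t` have the same elements, and the supremum
    -- contains the fresh element of `f i`.
    compare-sup : ∀ {I} (f : I → Tower) t → (∀ i → Comparable (f i) t) →
                  ⟦ sup I f ⟧ ⊆ ⟦ t ⟧ ⊎ ⟦ t ⟧ ⁺⊆ ⟦ sup I f ⟧
    compare-sup f t cmp with em {P = ∃ λ i → ¬ (⟦ f i ⟧ ⁺⊆ ⟦ t ⟧)}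
    ... | no all = inj₁ λ x∈ →
      let i , x∈⁺ = ∈-sup⁻ f x∈ in dne {P = ⟦ f i ⟧ ⁺⊆ ⟦ t ⟧} (λ n → all (i , n)) x∈⁺
    ... | yes (i , n) with cmp i
    ...   | inj₂ t⁺⊆fi , _          = inj₂ λ x∈⁺ → ∈-sup⁺ f i (inj₁ (t⁺⊆fi x∈⁺))
    ...   | inj₁ _     , inj₂ fi⁺⊆t = contradiction (λ {x} → fi⁺⊆t {x}) n
    ...   | inj₁ fi⊆t  , inj₁ t⊆fi  = inj₂ λ {x} x∈⁺ →
      ∈-sup⁺ f i (subst (x ∈⁺_) (⊆-antisym {⟦ t ⟧} t⊆fi fi⊆t) x∈⁺)

    opaque
      comparable : ∀ s t → Comparable s t
      comparable s@(sup I f) t@(sup J g) =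
        compare-sup f t (λ i → comparable (f i) t) ,
        compare-sup g s (λ j → swap (comparable s (g j)))

    ⊆-dichotomy : ∀ s t → ⟦ s ⟧ ⊆ ⟦ t ⟧ ⊎ ⟦ t ⟧ ⁺⊆ ⟦ s ⟧
    ⊆-dichotomy s t = proj₁ (comparable s t)

    containing : A → Tower
    containing x with em {P = ∃ λ t → x ∈ ⟦ t ⟧}
    ... | yes (t , _) = t
    ... | no _        = sup ⊥ λ ()

    ∈-containing : ∀ {x} t → x ∈ ⟦ t ⟧ → x ∈ ⟦ containing x ⟧
    ∈-containing {x} t x∈t with em {P = ∃ λ t → x ∈ ⟦ t ⟧}
    ... | yes (_ , x∈) = x∈
    ... | no none      = contradiction (t , x∈t) none

    -- As `Tower` is large, a supremum cannot range over all towers. One chosen tower for each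
    -- element of `A` is enough to include every stage.
    top : Tower
    top = sup A containing

    opaque
      ⊆-top : ∀ t → ⟦ t ⟧ ⊆ ⟦ top ⟧
      ⊆-top t {x} x∈t = ∈-sup⁺ containing x (inj₁ (∈-containing t x∈t))

      -- If an element were missing, `top` would have a fresh element; the stage after `top`
      -- contains it, yet is included in `top` like every stage.
      ∈-top : ∀ x → x ∈ ⟦ top ⟧
      ∈-top x = dne λ x∉ → let y , e = fresh-exists ⟦ top ⟧ x∉ in
        fresh-∉ ⟦ top ⟧ e (⊆-top (sup ⊤ (const top)) (∈-sup⁺ (const {B = ⊤} top) tt (inj₂ e)))

      birth : ∀ t {x} → x ∈ ⟦ t ⟧ → ∃ λ s → fresh ⟦ s ⟧ ≡ just x
      birth (sup I f) x∈ with ∈-sup⁻ f x∈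
      ... | i , inj₁ x∈fi = birth (f i) x∈fi
      ... | i , inj₂ e    = f i , e

    -- The elements of this stage are those adjoined before `x`, so it will be the initial segment
    -- below `x`.
    stage : A → Tower
    stage x = proj₁ (birth top (∈-top x))

    fresh-stage : ∀ x → fresh ⟦ stage x ⟧ ≡ just x
    fresh-stage x = proj₂ (birth top (∈-top x))

    stage-∌ : ∀ x → ¬ x ∈ ⟦ stage x ⟧
    stage-∌ x = fresh-∉ ⟦ stage x ⟧ (fresh-stage x)

    ∈⁺-stage : ∀ x → x ∈⁺ ⟦ stage x ⟧
    ∈⁺-stage x = inj₂ (fresh-stage x)

    stage-⊆ : ∀ t {x} → x ∈⁺ ⟦ t ⟧ → ⟦ stage x ⟧ ⊆ ⟦ t ⟧
    stage-⊆ t {x} x∈⁺ with ⊆-dichotomy (stage x) t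
    ... | inj₁ sx⊆t  = sx⊆t
    ... | inj₂ t⁺⊆sx = contradiction (t⁺⊆sx x∈⁺) (stage-∌ x)

    opaque
      -- Elements with equal stages coincide, both being the fresh element of that stage.
      -- Well-foundedness is by recursion on towers: if `x` enters `sup I f` through `f i`, then all
      -- predecessors of `x` lie in `f i`.
      zermelo : WellOrdering A
      zermelo = record
        { _⊏_         = λ x y → x ∈ ⟦ stage y ⟧
        ; irrefl      = stage-∌ _
        ; transitive  = λ x⊏y y⊏z → stage-⊆ (stage _) (inj₁ y⊏z) x⊏y
        ; total       = total
        ; wellFounded = λ x → accessible top (∈-top x)
        }
        where
        total : ∀ x y → x ∈ ⟦ stage y ⟧ ⊎ x ≡ y ⊎ y ∈ ⟦ stage x ⟧
        total x y with comparable (stage x) (stage y)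
        ... | inj₂ y⁺⊆x , _        = inj₂ (inj₂ (y⁺⊆x (∈⁺-stage y)))
        ... | inj₁ _   , inj₂ x⁺⊆y = inj₁ (x⁺⊆y (∈⁺-stage x))
        ... | inj₁ x⊆y , inj₁ y⊆x  = inj₂ (inj₁ (just-injective
          (trans (sym (fresh-stage x))
            (trans (cong fresh (⊆-antisym {⟦ stage x ⟧} x⊆y y⊆x)) (fresh-stage y)))))

        accessible : ∀ t {x} → x ∈ ⟦ t ⟧ → Acc (λ x y → x ∈ ⟦ stage y ⟧) x
        accessible (sup I f) x∈ with ∈-sup⁻ f x∈
        ... | i , x∈⁺ = acc λ y⊏x → accessible (f i) (stage-⊆ (f i) x∈⁺ y⊏x)

  open Zermelo using (zermelo)

  -- Initial ordinals.

  opaque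
    -- If some segment is as large as `K`, take the least `x` with such a segment and pull the order
    -- back along an injection of `K` into it. A segment of the new order injects into a segment
    -- below `x`, which by minimality is too small to receive `K`.
    initialWellOrdering : ∀ K → Σ (WellOrdering K) λ W → ∀ x → WellOrdering.Segment W x ≺ K
    initialWellOrdering K with em {P = ∃ λ x → K ≼ WellOrdering.Segment (zermelo K) x}
    ... | no small = zermelo K , λ x → value-injection _ , λ K≼ → small (x , K≼)
    ... | yes large with minimal (WellOrdering.wellFounded (zermelo K)) large
    ...   | x , i , least = W , λ y → value-injection _ , λ K≼ →
              least (v y) (v⊏x y) (↣-trans K≼ (segment y))
      where
      open WellOrdering (zermelo K) using (_⊏_; Segment)

      j : K ≼ K
      j = ↣-trans i (value-injection _)

      v : K → K
      v = to j

      v⊏x : ∀ y → v y ⊏ x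
      v⊏x y with to i y
      ... | _ , [ p ] = recompute em p

      W : WellOrdering K
      W = pullback j (zermelo K)

      segment : ∀ y → WellOrdering.Segment W y ≼ Segment (v y)
      segment y = mk↣ {to = λ (z , p) → v z , p}
        λ { {_ , _} {_ , _} e → injective (value-injection _) (injective j (cong value e)) }

  -- Images, lexicographic powers and infinite sets.

  image : {I A : Set} → (I → A) → Pred A 0ℓ
  image a x = ∃ λ i → a i ≡ x

  -- Excluded middle recovers an index from the irrelevant membership proof. The index depends on
  -- `y` alone, so this is a section of `a` over its image.
  preimage : {I A : Set} (a : I → A) (y : ⟪ image a ⟫) → ∃ λ i → a i ≡ value y
  preimage a (y , [ p ]) = recompute em p

  image-≼ : {I A : Set} (a : I → A) → ⟪ image a ⟫ ≼ I
  image-≼ a = mk↣ {to = proj₁ ∘ preimage a} λ {y} {z} e → injective (value-injection _)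
    (trans (sym (proj₂ (preimage a y))) (trans (cong a e) (proj₂ (preimage a z))))

  LexPower : ∀ {L} → WellOrdering L → LinearOrder → LinearOrder
  LexPower {L} W P =
    linear (L → Carrier P) _<ᴸ_ (λ (i , _ , lt) → P.irrefl refl lt) transitive total
    where
    module P = LinearOrder P
    module W = WellOrdering W
    open W using (_⊏_)

    _<ᴸ_ : Rel (L → Carrier P) 0ℓ
    f <ᴸ g = ∃ λ i → (∀ j → j ⊏ i → f j ≡ g j) × P [ f i < g i ]

    transitive : Transitive _<ᴸ_
    transitive {f} {g} {h} (i , f≈g , fi<gi) (j , g≈h , gj<hj) with W.total i j
    ... | inj₁ i⊏j = i , (λ k k⊏i → trans (f≈g k k⊏i) (g≈h k (W.transitive k⊏i i⊏j))) ,
                     subst (P [ f i <_]) (g≈h i i⊏j) fi<gi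
    ... | inj₂ (inj₁ refl) = i , (λ k k⊏i → trans (f≈g k k⊏i) (g≈h k k⊏i)) , P.trans fi<gi gj<hj
    ... | inj₂ (inj₂ j⊏i) = j , (λ k k⊏j → trans (f≈g k (W.transitive k⊏j j⊏i)) (g≈h k k⊏j)) ,
                     subst (P [_< h j ]) (sym (f≈g j j⊏i)) gj<hj

    total : ∀ f g → f <ᴸ g ⊎ f ≡ g ⊎ g <ᴸ f
    total f g with em {P = ∃ λ i → f i ≢ g i}
    ... | no same = inj₂ (inj₁ (ext λ i → dne λ ne → same (i , ne)))
    ... | yes differ with minimal W.wellFounded differ
    ...   | i , fi≢gi , least with P.compare (f i) (g i)
    ...     | tri< lt _ _ = inj₁ (i , (λ j j⊏i → dne (least j j⊏i)) , lt)
    ...     | tri≈ _ e _  = contradiction e fi≢gi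
    ...     | tri> _ _ gt = inj₂ (inj₂ (i , (λ j j⊏i → sym (dne (least j j⊏i))) , gt))

  opaque
    -- Distinct elements are chosen one after another; being stuck at `n` would mean that the first
    -- `n` of them exhaust `K`, making `K` finite.
    ℕ≼ : ∀ {K} → Infinite K → ℕ ≼ K
    ℕ≼ {K} inf with dependentChoice ℕ.<-wellFounded (const k₀) Good step
      where
      k₀ : K
      k₀ = dne λ ¬k → inf (0 , mk⤖ {to = ⊥-elim ∘ ¬k} ((λ {x} → ⊥-elim (¬k x)) , λ ()))

      Good : ∀ n → (∀ m → m ℕ.< n → K) → K → Set
      Good n g k = ∀ m (m<n : m ℕ.< n) → g m m<n ≢ k

      step : ∀ n (f : ℕ → K) → (∀ m → m ℕ.< n → Good m (λ l _ → f l) (f m)) →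
             ∃ (Good n (λ m _ → f m))
      step n f distinct = dne λ exhausted →
          inf (n , sym-≡ (mk⤖ {to = f ∘ toℕ} (inj , surj exhausted)))
        where
        inj : ∀ {i j : Fin n} → f (toℕ i) ≡ f (toℕ j) → i ≡ j
        inj {i} {j} e with ℕ.<-cmp (toℕ i) (toℕ j)
        ... | tri< i<j _ _ = contradiction e (distinct (toℕ j) (toℕ<n j) (toℕ i) i<j)
        ... | tri≈ _ i≡j _ = toℕ-injective i≡j
        ... | tri> _ _ j<i = contradiction (sym e) (distinct (toℕ i) (toℕ<n i) (toℕ j) j<i)

        surj : ¬ ∃ (Good n (λ m _ → f m)) → ∀ k → ∃ λ i → ∀ {j : Fin n} → j ≡ i → f (toℕ j) ≡ k
        surj exhausted k = dne λ missed → exhausted (k , λ m m<n fm≡k →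
          missed (fromℕ< m<n , λ { refl → trans (cong f (toℕ-fromℕ< m<n)) fm≡k }))
    ... | f , distinct = mk↣ {to = f} inj
      where
      inj : ∀ {m n} → f m ≡ f n → m ≡ n
      inj {m} {n} e with ℕ.<-cmp m n
      ... | tri< m<n _ _ = contradiction e (distinct n m m<n)
      ... | tri≈ _ m≡n _ = m≡n
      ... | tri> _ _ n<m = contradiction (sym e) (distinct m n n<m)

  -- Equivalence of the two forms of scatteredness.

  module _ {K : Set} where

    -- The image of a saturated order under an embedding is a saturated suborder: a gap is pulled
    -- back along `pre`, filled in `X`, and the filler is mapped forward.
    scattered⁺ : ∀ {P} → WeaklyScattered K P → Scattered K P
    scattered⁺ {P} ws X sat m =
      ws (image (proj₁ m) , (proj₁ m point , [ point , refl ]) , saturated)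
      where
      open Sat sat

      M : LinearOrder
      M = Suborder P (image (proj₁ m))

      pre : Carrier M → Carrier X
      pre y = proj₁ (preimage (proj₁ m) y)

      m-pre : ∀ y → proj₁ m (pre y) ≡ value y
      m-pre y = proj₂ (preimage (proj₁ m) y)

      pre-mono : ∀ {y z} → M [ y < z ] → X [ pre y < pre z ]
      pre-mono {y} {z} y<z = ↪-reflects-< {X} {P} m
        (subst₂ (LinearOrder._<_ P) (sym (m-pre y)) (sym (m-pre z)) y<z)

      saturated : (A B : Pred (Carrier M) 0ℓ) → ⟪ A ⟫ ≺ K → ⟪ B ⟫ ≺ K →
                  (∀ a b → A a → B b → M [ a < b ]) →
                  ∃ λ c → (∀ a → A a → M [ a < c ]) × (∀ b → B b → M [ c < b ])
      saturated A B A≺K B≺K A<B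
        with fill A≺K B≺K (pre ∘ value) (pre ∘ value)
             (λ { (a , [ p ]) (b , [ q ]) →
               pre-mono {a} {b} (A<B a b (recompute em p) (recompute em q)) })
      ... | c , A<c , c<B = (proj₁ m c , [ c , refl ]) ,
        (λ a Aa → subst (P [_< proj₁ m c ]) (m-pre a) (proj₂ m (A<c (a , [ Aa ])))) ,
        (λ b Bb → subst (P [ proj₁ m c <_]) (m-pre b) (proj₂ m (c<B (b , [ Bb ]))))

    scattered⁻ : ∀ {P} → Scattered K P → WeaklyScattered K P
    scattered⁻ {P} sc (S , point , saturated) = sc (Suborder P S) sat (value , λ x<y → x<y)
      where
      sat : Sat K (Suborder P S)
      sat = record
        { point = point
        ; fill  = λ I≺K J≺K a b a<b →
            let c , a<c , c<b = saturated (image a) (image b)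
                  (≼-≺-trans (image-≼ a) I≺K) (≼-≺-trans (image-≼ b) J≺K)
                  λ { _ _ (i , refl) (j , refl) → a<b i j }
            in c , (λ i → a<c (a i) (i , refl)) , (λ j → c<b (b j) (j , refl))
        }

  -- Scatteredness of lexicographic sums and powers.

  module Cardinal (K : Set) (inf : Infinite K) where

    Fin≺ : ∀ n → Fin n ≺ K
    Fin≺ n = ↣-trans (mk↣ toℕ-injective) (ℕ≼ inf) , λ K≼n →
      ℕ.1+n≰n (injective⇒≤ (injective
        (↣-trans (mk↣ (toℕ-injective {suc n})) (↣-trans (ℕ≼ inf) K≼n))))

    -- A filler lies in the interval as soon as both families are inhabited. An empty family is
    -- replaced by the end point on its side, which is possible because singletons are smaller than
    -- `K`.
    interval : ∀ {X} → Sat K X → ∀ {x y} → X [ x < y ] →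
               Sat K (Suborder X λ z → X [ x < z ] × X [ z < y ])
    interval {X} sat {x} {y} x<y = record { point = middle ; fill = fillᵢ }
      where
      open Sat sat
      module X = LinearOrder X

      Y : LinearOrder
      Y = Suborder X λ z → X [ x < z ] × X [ z < y ]

      between : (z : Carrier Y) → X [ x < value z ] × X [ value z < y ]
      between (z , [ p ]) = recompute em p

      middle : Carrier Y
      middle = let z , x<z , z<y = fill (Fin≺ 1) (Fin≺ 1) (const x) (const y) (λ _ _ → x<y)
               in z , [ x<z zero , z<y zero ]

      fillᵢ : ∀ {I J} → I ≺ K → J ≺ K → (a : I → Carrier Y) (b : J → Carrier Y) →
              (∀ i j → Y [ a i < b j ]) →
              ∃ λ c → (∀ i → Y [ a i < c ]) × (∀ j → Y [ c < b j ])
      fillᵢ {I} {J} I≺K J≺K a b a<b with em {P = I} | em {P = J}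
      ... | yes i | yes j =
        let c , a<c , c<b = fill I≺K J≺K (value ∘ a) (value ∘ b) a<b
        in (c , [ X.trans (proj₁ (between (a i))) (a<c i) ,
                  X.trans (c<b j) (proj₂ (between (b j))) ]) , a<c , c<b
      ... | yes i | no ¬j =
        let c , a<c , c<y = fill I≺K (Fin≺ 1) (value ∘ a) (const y)
                                 (λ i _ → proj₂ (between (a i)))
        in (c , [ X.trans (proj₁ (between (a i))) (a<c i) , c<y zero ]) , a<c , ⊥-elim ∘ ¬j
      ... | no ¬i | yes j =
        let c , x<c , c<b = fill (Fin≺ 1) J≺K (const x) (value ∘ b)
                                 (λ _ j → proj₁ (between (b j)))
        in (c , [ x<c zero , X.trans (c<b j) (proj₂ (between (b j))) ]) , ⊥-elim ∘ ¬i , c<b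
      ... | no ¬i | no ¬j = middle , ⊥-elim ∘ ¬i , ⊥-elim ∘ ¬j

    -- Filling below a single point shows that a saturated order has no least element, so an
    -- embedding would give an infinite descent in ℕ.
    ℕ-scattered : Scattered K ℕ-order
    ℕ-scattered X sat (m , mono) = descend (m point) (ℕ.<-wellFounded _) point refl
      where
      open Sat sat

      descend : ∀ n → Acc ℕ._<_ n → ∀ x → m x ≡ n → ⊥
      descend n (acc rs) x refl =
        let y , _ , y<x = fill (Fin≺ 0) (Fin≺ 1) (λ ()) (const x) (λ ())
        in descend (m y) (rs (mono (y<x zero))) y refl

    -- Either the first coordinates are pairwise distinct and embed `X` in `P`, or two points
    -- `x < y` share theirs. In the latter case everything between them lies in that one summand,
    -- and the interval is again saturated.
    LexSum-scattered : ∀ {P Q} → Scattered K P → (∀ p → Scattered K (Q p)) →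
                       Scattered K (LexSum P Q)
    LexSum-scattered {P} {Q} scP scQ X sat (m , mono)
      with em {P = ∃ λ x → ∃ λ y → X [ x < y ] × proj₁ (m x) ≡ proj₁ (m y)}
    ... | no distinct = scP X sat (proj₁ ∘ m , λ {x} {y} x<y → fst-mono x<y (mono x<y) refl refl)
      where
      fst-mono : ∀ {x y u v} → X [ x < y ] → LexSum P Q [ u < v ] → m x ≡ u → m y ≡ v →
                 P [ proj₁ u < proj₁ v ]
      fst-mono x<y (fst< lt) _  _  = lt
      fst-mono x<y (snd< lt) ex ey =
        contradiction (_ , _ , x<y , trans (cong proj₁ ex) (sym (cong proj₁ ey))) distinct
    ... | yes (x , y , x<y , e) =
      scQ (proj₁ (m x)) Y (interval sat x<y) (n , λ {z} {w} → n-mono {z} {w})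
      where
      Y : LinearOrder
      Y = Suborder X λ z → X [ x < z ] × X [ z < y ]

      squeeze : ∀ {u v w} → LexSum P Q [ u < v ] → LexSum P Q [ v < w ] → proj₁ u ≡ proj₁ w →
                proj₁ v ≡ proj₁ u
      squeeze (fst< lt) (fst< lt′) refl = ⊥-elim (LinearOrder.asym P lt lt′)
      squeeze (fst< lt) (snd< _)   refl = ⊥-elim (LinearOrder.irrefl P refl lt)
      squeeze (snd< _)  _          _    = refl

      fibre : (z : Carrier Y) → proj₁ (m (value z)) ≡ proj₁ (m x)
      fibre (z , [ p ]) = let x<z , z<y = recompute em p in squeeze (mono x<z) (mono z<y) e

      n : Carrier Y → Carrier (Q (proj₁ (m x)))
      n z = subst (Carrier ∘ Q) (fibre z) (proj₂ (m (value z)))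

      snd-mono : ∀ {u v p} (eu : proj₁ u ≡ p) (ev : proj₁ v ≡ p) → LexSum P Q [ u < v ] →
                 Q p [ subst (Carrier ∘ Q) eu (proj₂ u) < subst (Carrier ∘ Q) ev (proj₂ v) ]
      snd-mono refl refl (snd< lt) = lt
      snd-mono refl refl (fst< lt) = ⊥-elim (LinearOrder.irrefl P refl lt)

      n-mono : ∀ {z w} → Y [ z < w ] → Q (proj₁ (m x)) [ n z < n w ]
      n-mono {z} {w} z<w = snd-mono (fibre z) (fibre w) (mono z<w)

    -- Nested intervals (lo i, hi i) of a saturated X ↪ P^L on which the i-th
    -- coordinate is constant: the elements of X inside all of them would coincide.
    LexPower-scattered : ∀ {L P} (W : WellOrdering L) → L ≺ K → Scattered K P →
                         Scattered K (LexPower W P)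
    LexPower-scattered {L} {P} W L≺K scP X sat (m , mono) =
      let f , good = dependentChoice W.wellFounded (const (point , point)) Good step
          c , d , c<d , inside = twoPoints f L≺K (λ l → l) good
          k , _ , lt = mono c<d
          lo<c , d<hi = inside k
          _ , _ , constant = good k
      in P.irrefl (trans (constant _ (lo<c , X.trans c<d d<hi))
                         (sym (constant _ (X.trans lo<c c<d , d<hi)))) lt
      where
      module W = WellOrdering W
      open W using (_⊏_)
      open Sat sat
      module X = LinearOrder X
      module P = LinearOrder P

      Intervals : Set
      Intervals = L → Carrier X × Carrier X

      lo hi : Intervals → L → Carrier X
      lo f = proj₁ ∘ f
      hi f = proj₂ ∘ f

      Good : ∀ i → (∀ j → j ⊏ i → Carrier X × Carrier X) → Carrier X × Carrier X → Set
      Good i g (a , b) =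
        (∀ j j⊏i → X [ proj₁ (g j j⊏i) < a ] × X [ b < proj₂ (g j j⊏i) ]) ×
        X [ a < b ] ×
        (∀ z → X [ a < z ] × X [ z < b ] → m z i ≡ m a i)

      GoodAt : Intervals → L → Set
      GoodAt f i = Good i (λ j _ → f j) (f i)

      nested : ∀ f {i j} → GoodAt f i → GoodAt f j → X [ lo f i < hi f j ]
      nested f {i} {j} (outer-i , lo<hi-i , _) (outer-j , lo<hi-j , _) with W.total i j
      ... | inj₁ i⊏j         = X.trans (proj₁ (outer-j i i⊏j)) lo<hi-j
      ... | inj₂ (inj₁ refl) = lo<hi-i
      ... | inj₂ (inj₂ j⊏i)  = X.trans lo<hi-i (proj₂ (outer-i j j⊏i))

      -- `c` fills the gap between the lower and the upper end points, and `d` the gap between `c`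
      -- and the upper ones. The map `ι` allows for two uses: the predecessors of a coordinate in
      -- `step`, and all of `L` in the final contradiction.
      twoPoints : ∀ f {J} → J ≺ K → (ι : J → L) → (∀ j → GoodAt f (ι j)) →
                  ∃ λ c → ∃ λ d → X [ c < d ] ×
                    (∀ j → X [ lo f (ι j) < c ] × X [ d < hi f (ι j) ])
      twoPoints f J≺K ι good =
        let c , lo<c , c<hi = fill J≺K J≺K (lo f ∘ ι) (hi f ∘ ι)
                                   (λ i j → nested f (good i) (good j))
            d , c<d , d<hi  = fill (Fin≺ 1) J≺K (const c) (hi f ∘ ι) (λ _ → c<hi)
        in c , d , c<d zero , λ j → lo<c j , d<hi j

      -- The first difference of `m x` and `m y` is not below `i`, hence is at `i` or beyond it. So
      -- the `i`-th coordinate is weakly increasing where the earlier ones are constant.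
      coordinate : ∀ i {x y} → (∀ j → j ⊏ i → m x j ≡ m y j) → X [ x < y ] →
                   P [ m x i < m y i ] ⊎ m x i ≡ m y i
      coordinate i agree x<y with mono x<y
      ... | k , eq , lt with W.total k i
      ...   | inj₁ k⊏i         = ⊥-elim (P.irrefl (agree k k⊏i) lt)
      ...   | inj₂ (inj₁ refl) = inj₁ lt
      ...   | inj₂ (inj₂ i⊏k)  = inj₂ (eq i i⊏k)

      step : ∀ i f → (∀ j → j ⊏ i → GoodAt f j) → ∃ (Good i (λ j _ → f j))
      step i f good
        with twoPoints f (≼-≺-trans (value-injection (_⊏ i)) L≺K) value
               (λ (j , [ j⊏i ]) → good j (recompute em j⊏i))
      ... | c , d , c<d , inside = proceed em
        where
        agree : ∀ {x y} → X [ c < x ] × X [ x < d ] → X [ c < y ] × X [ y < d ] →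
                ∀ j → j ⊏ i → m x j ≡ m y j
        agree (c<x , x<d) (c<y , y<d) j j⊏i =
          let lo<c , d<hi = inside (j , [ j⊏i ])
              _ , _ , constant = good j j⊏i
          in trans (constant _ (X.trans lo<c c<x , X.trans x<d d<hi))
                   (sym (constant _ (X.trans lo<c c<y , X.trans y<d d<hi)))

        Y : LinearOrder
        Y = Suborder X λ z → X [ c < z ] × X [ z < d ]

        Repetition : Set
        Repetition = ∃ λ x → ∃ λ y → (X [ c < x ] × X [ x < d ]) × (X [ c < y ] × X [ y < d ]) ×
                     X [ x < y ] × m x i ≡ m y i

        proceed : Dec Repetition → ∃ (Good i (λ j _ → f j))
        -- Without repetitions the `i`-th coordinate would be strictly increasing on `(c, d)`,
        -- embedding a saturated interval in `P`.
        proceed (no distinct) =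
          ⊥-elim (scP Y (interval sat c<d)
            ((λ z → m (value z) i) , λ {x} {y} → coordinate-mono x y))
          where
          coordinate-mono : ∀ x y → Y [ x < y ] → P [ m (value x) i < m (value y) i ]
          coordinate-mono (x , [ p ]) (y , [ q ]) x<y =
            let x∈ = recompute em p
                y∈ = recompute em q
            in fromInj₁ (λ e → contradiction (x , y , x∈ , y∈ , x<y , e) distinct)
                        (coordinate i (agree x∈ y∈) x<y)
        -- A weakly increasing coordinate with equal values at `x` and `y` is constant between them,
        -- so `(x, y)` is the next interval.
        proceed (yes (x , y , x∈@(c<x , _) , y∈@(_ , y<d) , x<y , mx≡my)) =
          (x , y) ,
          (λ j j⊏i → let lo<c , d<hi = inside (j , [ j⊏i ])
                     in X.trans lo<c c<x , X.trans y<d d<hi) ,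
          x<y ,
          squeeze
          where
          squeeze : ∀ z → X [ x < z ] × X [ z < y ] → m z i ≡ m x i
          squeeze z (x<z , z<y)
            with z∈ ← X.trans c<x x<z , X.trans z<y y<d
            with coordinate i (agree x∈ z∈) x<z | coordinate i (agree z∈ y∈) z<y
          ... | inj₂ mx≡mz | _          = sym mx≡mz
          ... | inj₁ _     | inj₂ mz≡my = trans mz≡my (sym mx≡my)
          ... | inj₁ mx<mz | inj₁ mz<my = ⊥-elim (P.irrefl mx≡my (P.trans mx<mz mz<my))

  -- From a bound for `n` to a bound for `n + 1`.

  segmentOrdering : ∀ {A} (W : WellOrdering A) x → WellOrdering (WellOrdering.Segment W x)
  segmentOrdering W x = pullback (value-injection _) W

  PowerSum : (φ : LinearOrder) → WellOrdering (Carrier φ) → LinearOrder → LinearOrder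
  PowerSum φ W σ = LexSum φ λ p → LexPower (segmentOrdering W p) σ

  Arrow-suc : ∀ {φ σ n} (W : WellOrdering (Carrier φ)) → Carrier σ → Arrow σ φ n →
              Arrow (PowerSum φ W σ) φ (suc n)
  Arrow-suc {φ} {σ} {n} W s₀ arrow R R-sym R-irr
    with em {P = ∃ λ x → Σ (σ ↪ PowerSum φ W σ) λ e → ∀ r → R x (proj₁ e r)}
  ... | yes (x , e , Rx) with arrow (λ r s → R (proj₁ e r) (proj₁ e s)) R-sym R-irr
  ...   | inj₁ (h , ind) = inj₁ (↪-trans {φ} {σ} {PowerSum φ W σ} h e , ind)
  ...   | inj₂ (g , clq) = inj₂ (g⁺ , λ {i} {j} → clq⁺ i j)
    where
    g⁺ : Fin (suc n) → Carrier (PowerSum φ W σ)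
    g⁺ zero    = x
    g⁺ (suc i) = proj₁ e (g i)

    clq⁺ : ∀ i j → i ≢ j → R (g⁺ i) (g⁺ j)
    clq⁺ zero    zero    i≢j = contradiction refl i≢j
    clq⁺ zero    (suc j) _   = Rx (g j)
    clq⁺ (suc i) zero    _   = R-sym (Rx (g i))
    clq⁺ (suc i) (suc j) i≢j = clq (i≢j ∘ cong suc)
  Arrow-suc {φ} {σ} W s₀ arrow R R-sym R-irr | no omits =
    let f , avoids = dependentChoice W.wellFounded (λ _ _ → s₀) Avoids step in
    -- The chosen points lie in different summands, so they are ordered as in `φ`. Of two of them,
    -- the one later in `⊏` was chosen to avoid the neighbourhood of the other.
    inj₁ (((λ p → p , f p) , fst<) , λ p q → case W.total p q of λ where
      (inj₁ p⊏q)         → avoids q p p⊏q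
      (inj₂ (inj₁ refl)) → R-irr
      (inj₂ (inj₂ q⊏p))  → avoids p q q⊏p ∘ R-sym)
    where
    module W = WellOrdering W
    open W using (_⊏_; Segment)

    Avoids : ∀ p → (∀ q → q ⊏ p → Segment q → Carrier σ) → (Segment p → Carrier σ) → Set
    Avoids p g s = ∀ q (q⊏p : q ⊏ p) → ¬ R (q , g q q⊏p) (p , s)

    step : ∀ p (f : ∀ q → Segment q → Carrier σ) →
           (∀ q → q ⊏ p → Avoids q (λ r _ → f r) (f q)) → ∃ (Avoids p (λ q _ → f q))
    step p f _ =
      -- An inner recursion fixes the coordinates `q ⊏ p` of the point in the `p`-th summand. What
      -- `Secures` guarantees holds for all ways of continuing beyond `q`, and therefore for the
      -- finished `s`.
      let s , secures = dependentChoice S.wellFounded (const s₀) Secures secure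
      in s , λ q q⊏p → secures (q , [ q⊏p ]) s (λ _ _ → refl) refl
      where
      module S = WellOrdering (segmentOrdering W p)

      -- Setting the q-th coordinate to v ensures that (p , s) ∉ N(x_q).
      Secures : ∀ q → (∀ r → r S.⊏ q → Carrier σ) → Carrier σ → Set
      Secures q g v = ∀ s → (∀ r r⊏q → s r ≡ g r r⊏q) → s q ≡ v →
                      ¬ R (value q , f (value q)) (p , s)

      secure : ∀ q (g : Segment p → Carrier σ) →
               (∀ r → r S.⊏ q → Secures r (λ t _ → g t) (g r)) → ∃ (Secures q (λ r _ → g r))
      secure q g _ = dne λ none →
        omits (_ , (((λ v → p , s none v) , λ {v} {w} → s-mono none v w) , adjacent none))
        where
        Unsecured : Set
        Unsecured = ¬ ∃ (Secures q (λ r _ → g r))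

        extension : Unsecured → ∀ v → ∃ λ s → (∀ r → r S.⊏ q → s r ≡ g r) × s q ≡ v ×
                                              R (value q , f (value q)) (p , s)
        extension none v = dne λ ¬ext →
          none (v , λ s below at adj → ¬ext (s , below , at , adj))

        s : Unsecured → Carrier σ → Segment p → Carrier σ
        s none v = proj₁ (extension none v)

        adjacent : ∀ none v → R (value q , f (value q)) (p , s none v)
        adjacent none v = let _ , _ , _ , adj = extension none v in adj

        -- Both sequences agree with `g` below `q`, so they first differ at `q`, where their values
        -- are `v` and `w`. Hence the sequences form a copy of `σ` inside one neighbourhood.
        s-mono : ∀ none v w → σ [ v < w ] → PowerSum φ W σ [ (p , s none v) < (p , s none w) ]
        s-mono none v w v<w =
          let _ , below-v , at-v , _ = extension none v
              _ , below-w , at-w , _ = extension none w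
          in snd< (q , (λ r r⊏q → trans (below-v r r⊏q) (sym (below-w r r⊏q))) ,
                   subst₂ (LinearOrder._<_ σ) (sym at-v) (sym at-w) v<w)

  -- From graphs back to colourings of pairs.

  Arrow⇒⟶ : ∀ {τ φ n} → Arrow τ φ n → τ ⟶⟨ φ , n ⟩²
  Arrow⇒⟶ {τ} {φ} {n} arrow P (i , i-iso) f =
    conclude (Arrow-↪ {τ} {P} {φ} (inverse , inverse-mono) arrow R R-sym R-irr)
    where
    module P = LinearOrder P
    module I = IsOrderIsomorphism i-iso

    inverse : Carrier τ → Carrier P
    inverse y = proj₁ (I.surjective y)

    i-inverse : ∀ y → i (inverse y) ≡ y
    i-inverse y = proj₂ (I.surjective y) refl

    inverse-mono : ∀ {x y} → τ [ x < y ] → P [ inverse x < inverse y ]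
    inverse-mono x<y =
      I.cancel (subst₂ (LinearOrder._<_ τ) (sym (i-inverse _)) (sym (i-inverse _)) x<y)

    -- `f` colours increasing pairs only, so adjacency is the symmetric closure of having colour 1.
    Edge R : Rel (Carrier P) 0ℓ
    Edge x y = Σ (P [ x < y ]) λ x<y → f ((x , y) , [ x<y ]) ≡ suc zero
    R x y = Edge x y ⊎ Edge y x

    R-sym : Symmetric R
    R-sym = [ inj₂ , inj₁ ]′

    R-irr : ∀ {x} → ¬ R x x
    R-irr (inj₁ (x<x , _)) = P.irrefl refl x<x
    R-irr (inj₂ (x<x , _)) = P.irrefl refl x<x

    conclude : (Σ (φ ↪ P) λ h → ∀ p q → ¬ R (proj₁ h p) (proj₁ h q))
             ⊎ (Σ (Fin n → Carrier P) λ g → ∀ {i j} → i ≢ j → R (g i) (g j)) →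
               (∃ λ (Q : Pred (Carrier P) 0ℓ) → Suborder P Q ≅ φ × ConstantOn P f zero Q)
             ⊎ (∃ λ (Q : Pred (Carrier P) 0ℓ) → ⟪ Q ⟫ ⤖ Fin n × ConstantOn P f (suc zero) Q)
    conclude (inj₁ (h , ind)) = inj₁ (image (proj₁ h) , (pre , pre-iso) , independent)
      where
      M : LinearOrder
      M = Suborder P (image (proj₁ h))

      pre : Carrier M → Carrier φ
      pre y = proj₁ (preimage (proj₁ h) y)

      h-pre : ∀ y → proj₁ h (pre y) ≡ value y
      h-pre y = proj₂ (preimage (proj₁ h) y)

      pre-iso : IsOrderIsomorphism _≡_ _≡_ (LinearOrder._<_ M) (LinearOrder._<_ φ) pre
      pre-iso = record
        { isOrderMonomorphism = record
          { isOrderHomomorphism = record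
            { cong = cong pre
            ; mono = λ {y} {z} y<z → ↪-reflects-< {φ} {P} h
                (subst₂ (LinearOrder._<_ P) (sym (h-pre y)) (sym (h-pre z)) y<z)
            }
          ; injective = injective (image-≼ (proj₁ h))
          ; cancel    = λ {y} {z} lt →
              subst₂ (LinearOrder._<_ P) (h-pre y) (h-pre z) (proj₂ h lt)
          }
        ; surjective = λ p → (proj₁ h p , [ p , refl ]) ,
            λ { refl → ↪-injective {φ} {P} h (h-pre (proj₁ h p , [ p , refl ])) }
        }

      independent : ConstantOn P f zero (image (proj₁ h))
      independent ((_ , _) , [ lt ]) (p , refl) (q , refl)
        with f ((proj₁ h p , proj₁ h q) , [ lt ]) in e
      ... | zero     = refl
      ... | suc zero = contradiction (inj₁ (recompute em lt , e)) (ind p q)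
    conclude (inj₂ (g , clq)) = inj₂ (image g , mk⤖ (injective (image-≼ g) , onto) , clique)
      where
      onto : ∀ i → ∃ λ y → ∀ {z} → z ≡ y → to (image-≼ g) z ≡ i
      -- The index `j` recovered from `g i` must be `i`: otherwise adjacency of `g j` and `g i`,
      -- which are equal, would be a loop.
      onto i = (g i , [ i , refl ]) , λ { refl → dne λ j≢i →
        R-irr (subst (λ x → R x (g i)) (proj₂ (preimage g (g i , [ i , refl ]))) (clq j≢i)) }

      clique : ConstantOn P f (suc zero) (image g)
      clique ((_ , _) , [ lt ]) (i , refl) (j , refl)
        with clq {i} {j} (λ { refl → P.irrefl refl (recompute em lt) })
      ... | inj₁ (_ , e)     = e
      ... | inj₂ (gj<gi , _) = ⊥-elim (P.asym gj<gi (recompute em lt))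

  -- Cardinal arithmetic and the common bound.

  module _ (K : Set) (inf : Infinite K) (wp : IsWeakPower K K)
           (φ : LinearOrder) (φ-scattered : Scattered K φ) (φ≼K : Carrier φ ≼ K) where

    open Cardinal K inf

    -- A pair is a function on `Fin 2`, and 2 < κ, so κ^{<κ} = κ applies.
    K×K≼K : (K × K) ≼ K
    K×K≼K = ↣-trans pair (proj₁ wp (Fin 2) (Fin≺ 2))
      where
      pair : (K × K) ≼ (Fin 2 → K)
      pair = mk↣ {to = λ { (x , y) zero → x ; (x , y) (suc _) → y }}
        λ e → cong₂ _,_ (cong-app e zero) (cong-app e (suc zero))

    →-≼ : ∀ {L A} → L ≺ K → A ≼ K → (L → A) ≼ K
    →-≼ L≺K A≼K = ↣-trans
      (mk↣ {to = to A≼K ∘_} λ e → ext λ l → injective A≼K (cong-app e l))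
      (proj₁ wp _ L≺K)

    W : WellOrdering (Carrier φ)
    W = pullback φ≼K (proj₁ (initialWellOrdering K))

    segment≺K : ∀ p → WellOrdering.Segment W p ≺ K
    segment≺K p = ≼-≺-trans
      (mk↣ {to = λ (q , q⊏p) → to φ≼K q , q⊏p} λ { {_ , _} {_ , _} e →
        injective (value-injection _) (injective φ≼K (cong value e)) })
      (proj₂ (initialWellOrdering K) (to φ≼K p))

    record Bound (n : ℕ) : Set₁ where
      field
        τ         : LinearOrder
        scattered : Scattered K τ
        small     : Carrier τ ≼ K
        -- Supplies the default value for the recursive choices in `Arrow-suc`.
        point     : Carrier τ
        arrow     : Arrow τ φ n

    bound : Carrier φ → ∀ n → Bound n
    -- The empty clique makes every order a bound for 0; ℕ is one that is inhabited, scattered and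
    -- of size at most κ.
    bound p₀ zero = record
      { τ         = ℕ-order
      ; scattered = ℕ-scattered
      ; small     = ℕ≼ inf
      ; point     = 0
      ; arrow     = λ _ _ _ → inj₂ ((λ ()) , λ { {()} })
      }
    bound p₀ (suc n) = record
      { τ         = PowerSum φ W τ
      ; scattered = LexSum-scattered {φ} φ-scattered λ p →
          LexPower-scattered {P = τ} (segmentOrdering W p) (segment≺K p) scattered
      ; small     = ↣-trans (Σ-≼ φ≼K λ p → →-≼ (segment≺K p) small) K×K≼K
      ; point     = p₀ , const point
      ; arrow     = Arrow-suc W point arrow
      }
      where open Bound (bound p₀ n)

    commonBound : ∃ λ τ → Scattered K τ × Carrier τ ≼ K × (∀ n → Arrow τ φ n)
    commonBound with em {P = Carrier φ}
    -- The bounds are inhabited only by means of a point of `φ`. An empty `φ` is its own bound, the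
    -- identity being vacuously independent.
    ... | no empty = φ , φ-scattered , φ≼K ,
      λ n R _ _ → inj₁ (((λ p → p) , λ p<q → p<q) , λ p → contradiction p empty)
    -- The bound for each `n` is a summand, and a graph on the sum restricts to it. The sum stays
    -- scattered because ℕ is, and small because κ · κ = κ.
    ... | yes p₀ = sum ,
      LexSum-scattered {ℕ-order} {τ ∘ bound p₀} ℕ-scattered (scattered ∘ bound p₀) ,
      ↣-trans (Σ-≼ (ℕ≼ inf) (small ∘ bound p₀)) K×K≼K ,
      λ n → Arrow-↪ {τ (bound p₀ n)} {sum} {φ} (summand ℕ-order (τ ∘ bound p₀) n)
              (arrow (bound p₀ n))
      where
      open Bound

      sum : LinearOrder
      sum = LexSum ℕ-order (τ ∘ bound p₀)

theorem3p1 : (∀ {ℓ} → ExcludedMiddle ℓ) →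
    (∀ {a b} → Extensionality a b) →
    ∀ (K : Set) → Infinite K → IsWeakPower K K →
    ∀ (φ : LinearOrder) → WeaklyScattered K φ → LinearOrder.Carrier φ ≼ K →
    ∃ λ (τ : LinearOrder) →
    WeaklyScattered K τ × LinearOrder.Carrier τ ≼ K × (∀ n → τ ⟶⟨ φ , n ⟩²)
theorem3p1 em ext K inf wp φ φ-ws φ≼K =
  let τ , τ-scattered , τ≼K , arrow = commonBound K inf wp φ (scattered⁺ {P = φ} φ-ws) φ≼K
  in τ , scattered⁻ {P = τ} τ-scattered , τ≼K , λ n → Arrow⇒⟶ {τ} {φ} (arrow n)
  where open Classical em ext
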